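{- Let $n\ge 21$ be an integer and let $G$ be a connected, non-complete graph of order $n$ with $\delta(G)\ge 3$. If $C(G)$ is a linear forest and $\sigma_4(G)\ge \frac{4n-19}{5}$, then $cfc(G)=2$.
   Context: All graphs are finite, without loops or multiple edges; the order of $G$ is $|V(G)|$, $d_G(v)$ is the degree of $v$ in $G$, and $\delta(G)$ is the minimum degree of $G$. $\sigma_4(G)$ is the minimum of $\sum_{s\in S} d_G(s)$ over all independent sets $S\subseteq V(G)$ (no two vertices adjacent) with $|S|=4$; by convention $\sigma_4(G)=+\infty$ if $G$ has no independent set of size $4$. A cut-edge of a connected graph is an edge whose deletion increases the number of components. $C(G)$ denotes the subgraph of $G$ formed (induced) by the cut-edges of $G$; it is a linear forest if each of its components is a path (the case of no cut-edges, i.e. zero components, is included). Given an edge-colouring of $G$ (not necessarily proper), a path is conflict-free if some colour appears on exactly one of its edges. An edge-coloured graph is conflict-free connected if every pair of distinct vertices is connected by a conflict-free path. The conflict-free connection number $cfc(G)$ of a connected graph $G$ is the minimum number of colours in an edge-colouring making $G$ conflict-free connected. -}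

module Defs where

open import Data.Bool.Base using (true; false)
open import Data.Fin.Base using (Fin; toℕ)
open import Data.Fin.Properties using (all?; _≟_)
open import Data.Fin.Subset using (Subset; inside; outside; _∈_; ∣_∣)
open import Data.Fin.Subset.Properties using (_∈?_)
open import Data.Integer.Base using (+_)
open import Data.List.Base using (List; []; _∷_; [_]; _++_; map; filter; length; allFin)
open import Data.Nat.ListAction using (sum)
open import Data.List.Extrema using (min)
open import Data.List.Extrema.Nat using () renaming (min to minℕ)
import Data.List.Membership.Propositional as List
open import Data.List.Membership.Propositional.Properties using (∈-++⁺ˡ; ∈-++⁺ʳ; ∈-map⁺)
open import Data.List.Relation.Unary.Any using (here)
open import Data.List.Relation.Unary.Unique.Propositional using (Unique)
import Data.Maybe.Base as Maybe
open import Data.Nat.Base using (ℕ; zero; suc; _≤_; _<_)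
import Data.Nat.Properties as ℕ
open import Data.Product.Base using (Σ; ∃; ∃-syntax; _×_; _,_; proj₁)
open import Data.Rational.Unnormalised.Base as ℚᵘ using (ℚᵘ; _/_)
open import Data.Sum.Base using (_⊎_)
open import Data.Vec.Base as Vec using ()
open import Function.Bundles using (_⇔_)
open import Function.Definitions using (Injective; Surjective)
open import Level using (0ℓ)
open import Relation.Binary.Bundles using (TotalOrder)
open import Relation.Binary.Construct.Add.Supremum.NonStrict using (≤⁺-isTotalOrder-≡)
import Relation.Binary.Construct.Add.Supremum.NonStrict ℚᵘ._≤_ as ℚ∞
open import Relation.Binary.Construct.Closure.ReflexiveTransitive using (Star; ε; _◅_)
open import Relation.Binary.Core using (Rel)
open import Relation.Binary.Definitions using (Decidable; Symmetric; Irreflexive)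
open import Relation.Binary.PropositionalEquality.Core using (_≡_; _≢_; refl)
open import Relation.Nullary.Decidable using (Dec; ¬?; _→-dec_; _×-dec_)
open import Relation.Nullary.Construct.Add.Supremum using (_⁺; ⊤⁺) renaming ([_] to fin)
open import Relation.Nullary.Negation.Core using (¬_)

record Graph (n : ℕ) : Set₁ where
  field
    Adj    : Rel (Fin n) 0ℓ
    adj?   : Decidable Adj
    sym    : Symmetric Adj
    irrefl : Irreflexive _≡_ Adj

open Graph public

module _ {n : ℕ} (G : Graph n) where

  Connected : Set
  Connected = ∀ u v → Star (Adj G) u v

  Complete : Set
  Complete = ∀ u v → u ≢ v → Adj G u v

  degree : Fin n → ℕ
  degree v = length (filter (adj? G v) (allFin n))

  -- Every degree is below n, so the initial value n only matters when there
  -- are no vertices.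
  δ : ℕ
  δ = minℕ n (map degree (allFin n))

subsets : ∀ n → List (Subset n)
subsets zero    = Vec.[] ∷ []
subsets (suc n) = map (inside Vec.∷_) (subsets n) ++ map (outside Vec.∷_) (subsets n)

∈-subsets : ∀ {n} (S : Subset n) → S List.∈ subsets n
∈-subsets Vec.[]          = here refl
∈-subsets (true Vec.∷ S)  = ∈-++⁺ˡ (∈-map⁺ (inside Vec.∷_) (∈-subsets S))
∈-subsets (false Vec.∷ S) =
  ∈-++⁺ʳ (map (inside Vec.∷_) (subsets _)) (∈-map⁺ (outside Vec.∷_) (∈-subsets S))

-- ℕ extended by +∞, which is written ⊤⁺.
ℕ∞ : Set
ℕ∞ = ℕ ⁺

ℕ∞-totalOrder : TotalOrder 0ℓ 0ℓ 0ℓ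
ℕ∞-totalOrder = record { isTotalOrder = ≤⁺-isTotalOrder-≡ _≤_ ℕ.≤-isTotalOrder }

module _ {n : ℕ} (G : Graph n) where

  Independent : Subset n → Set
  Independent S = ∀ u v → u ∈ S → v ∈ S → ¬ Adj G u v

  independent? : ∀ S → Dec (Independent S)
  independent? S = all? λ u → all? λ v →
    (u ∈? S) →-dec ((v ∈? S) →-dec ¬? (adj? G u v))

  degreeSum : Subset n → ℕ
  degreeSum S = sum (map (degree G) (filter (_∈? S) (allFin n)))

  independentSets : ℕ → List (Subset n)
  independentSets k = filter (λ S → independent? S ×-dec (∣ S ∣ ℕ.≟ k)) (subsets n)

  σ : ℕ → ℕ∞
  σ k = min ℕ∞-totalOrder ⊤⁺ (map (λ S → fin (degreeSum S)) (independentSets k))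

infix 4 _≤∞_

_≤∞_ : ℚᵘ → ℕ∞ → Set
q ≤∞ x = fin q ℚ∞.≤⁺ Maybe.map (λ s → + s / 1) x

-- The relation E has exactly k components: the vertices can be labelled by
-- Fin k, using every label, so that two vertices share a label iff they are
-- joined by a walk.
HasComponents : ∀ {n} → Rel (Fin n) 0ℓ → ℕ → Set
HasComponents {n} E k = ∃[ label ]
  Surjective {A = Fin n} {B = Fin k} _≡_ _≡_ label ×
  (∀ u v → label u ≡ label v ⇔ Star E u v)

record Subgraph (n : ℕ) : Set₁ where
  field
    Vertex : Fin n → Set
    Edge   : Rel (Fin n) 0ℓ

open Subgraph public

module _ {n : ℕ} (G : Graph n) where

  Delete : Fin n → Fin n → Rel (Fin n) 0ℓ
  Delete u v x y = Adj G x y × ¬ ((x ≡ u × y ≡ v) ⊎ (x ≡ v × y ≡ u))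

  CutEdge : Rel (Fin n) 0ℓ
  CutEdge u v = Adj G u v ×
    (∃[ k ] ∃[ l ] HasComponents (Adj G) k × HasComponents (Delete u v) l × k < l)

  C : Subgraph n
  C .Vertex v = ∃[ w ] CutEdge v w
  C .Edge     = CutEdge

PathEdge : ∀ {m} → Rel (Fin m) 0ℓ
PathEdge i j = toℕ j ≡ suc (toℕ i) ⊎ toℕ i ≡ suc (toℕ j)

-- The component of v in H is isomorphic, via p, to the path on m vertices.
ComponentIsPath : ∀ {n} → Subgraph n → Fin n → Set
ComponentIsPath {n} H v = ∃[ m ] Σ (Fin m → Fin n) λ p →
  Injective _≡_ _≡_ p ×
  (∀ u → Star (Edge H) v u ⇔ (∃[ i ] p i ≡ u)) ×
  (∀ i j → Edge H (p i) (p j) ⇔ PathEdge i j)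

LinearForest : ∀ {n} → Subgraph n → Set
LinearForest H = ∀ v → Vertex H v → ComponentIsPath H v

module _ {n : ℕ} (G : Graph n) where

  vertices : ∀ {u v} → Star (Adj G) u v → List (Fin n)
  vertices {u} ε       = [ u ]
  vertices {u} (_ ◅ w) = u ∷ vertices w

  Path : Rel (Fin n) 0ℓ
  Path u v = Σ (Star (Adj G) u v) λ w → Unique (vertices w)

  -- The second field says that the colour depends only on the unordered pair
  -- of endpoints, and in particular not on the proof of adjacency.
  record EdgeColouring (k : ℕ) : Set where
    field
      colour    : ∀ {u v} → Adj G u v → Fin k
      symmetric : ∀ {u v} (e : Adj G u v) (e′ : Adj G v u) → colour e ≡ colour e′

  open EdgeColouring public

  module _ {k : ℕ} (c : EdgeColouring k) where

    colours : ∀ {u v} → Star (Adj G) u v → List (Fin k)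
    colours ε       = []
    colours (e ◅ w) = colour c e ∷ colours w

    ConflictFree : ∀ {u v} → Path u v → Set
    ConflictFree p = ∃[ a ] length (filter (a ≟_) (colours (proj₁ p))) ≡ 1

    ConflictFreeConnected : Set
    ConflictFreeConnected = ∀ u v → u ≢ v → Σ (Path u v) ConflictFree

IsLeast : (ℕ → Set) → ℕ → Set
IsLeast P k = P k × (∀ j → P j → k ≤ j)

-- "cfc(G) = k".  Not every colour in Fin k has to be used, which does not
-- affect the minimum.
cfc_≐_ : ∀ {n} → Graph n → ℕ → Set
cfc G ≐ k = IsLeast (λ j → Σ (EdgeColouring G j) (ConflictFreeConnected G)) k

{-# OPTIONS --safe #-}

-- Fix a spanning tree T.  Colour its edges 0, except for at most one bridge e₀
-- of G, and colour all other edges 1.  If e₀ separates u from v, the path from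
-- u to v in T contains e₀ and no other edge of colour 1.  If not, and that path
-- contains an edge ab that is not a bridge of G, some edge xy outside T joins
-- the two sides of T − ab; going from u to x and from y to v on these sides
-- yields a path on which only xy has colour 1.  There remain the paths made of
-- bridges: they are harmless when e₀ belongs to every pair of adjacent bridges
-- (a cherry), because then they have length one.
--
-- Such an e₀ exists unless two cherries have distinct centres u, v that are not
-- joined by a bridge.  Deleting the four edges of these cherries splits G into
-- five pieces, and each piece has a vertex incident with none of the four.  The
-- closed neighbourhoods of these five vertices are disjoint, so their degrees
-- sum to at most n − 5; averaging over the sets of four of them contradicts the
-- bound on σ₄.

module Submission where

open import Defs
open import Data.Integer.Base using (+_; _-_)
open import Data.Nat.Base using (ℕ; _*_; _≤_)
open import Data.Rational.Unnormalised.Base using (_/_)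
open import Relation.Nullary.Negation.Core using (¬_)

open import Data.Bool.Base using (Bool; true; false; if_then_else_)
import Data.Bool.Properties as Bool
open import Data.Empty using (⊥)
open import Data.Fin.Base using (Fin; zero; suc; toℕ; fromℕ<)
open import Data.Fin.Patterns using (0F; 1F; 2F; 3F; 4F; 5F)
open import Data.Fin.Properties using (any?; all?; _≟_; toℕ<n; toℕ-injective; injective⇒≤)
open import Data.Fin.Subset as Subset using (Subset; _∪_; ⁅_⁆; ∣_∣)
import Data.Fin.Subset.Properties as Subset
import Data.Integer.Base as ℤ
import Data.Integer.Properties as ℤ
open import Data.List.Base
  using (List; []; _∷_; _++_; filter; length; lookup; map; allFin; concat; cartesianProduct)
open import Data.List.Extrema ℕ∞-totalOrder using (min≤xs)
open import Data.List.Extrema.Nat using () renaming (min≤xs to minℕ≤xs)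
import Data.List.Membership.DecPropositional as DecMembership
open import Data.List.Membership.Propositional using (_∈_; _∉_)
open import Data.List.Membership.Propositional.Properties
  using (∈-map⁺; ∈-filter⁺; ∈-filter⁻; ∈-allFin; ∈-lookup; ∈-cartesianProduct⁺)
open import Data.List.Membership.Propositional.Properties.WithK using (unique∧set⇒bag)
open import Data.List.Properties using (filter-++; length-++)
open import Data.List.Relation.Binary.BagAndSetEquality using (∼bag⇒↭)
open import Data.List.Relation.Binary.Disjoint.Propositional using (Disjoint)
import Data.List.Relation.Binary.Permutation.Propositional.Properties as ↭
open import Data.List.Relation.Unary.All as All using (All; []; _∷_)
import Data.List.Relation.Unary.All.Properties as All
open import Data.List.Relation.Unary.AllPairs as AllPairs using (AllPairs; []; _∷_; allPairs?)
import Data.List.Relation.Unary.AllPairs.Properties as AllPairs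
open import Data.List.Relation.Unary.Any using (here; there)
open import Data.List.Relation.Unary.Unique.Propositional using (Unique)
open import Data.List.Relation.Unary.Unique.Propositional.Properties
  using (++⁺; filter⁺; allFin⁺; concat⁺; Unique[x∷xs]⇒x∉xs)
open import Data.Nat.Base using (zero; suc; _+_; _<_; z≤n; s≤s)
open import Data.Nat.ListAction using (sum)
open import Data.Nat.ListAction.Properties using (sum-↭)
import Data.Nat.Properties as ℕ
open import Data.Nat.Solver using (module +-*-Solver)
open import Data.Product.Base using (Σ; ∃-syntax; _×_; _,_; proj₁; proj₂)
import Data.Rational.Unnormalised.Base as ℚᵘ
import Data.Rational.Unnormalised.Properties as ℚᵘ
open import Data.Sum.Base as Sum using (_⊎_; inj₁; inj₂)
open import Data.Vec.Base using (Vec; []; _∷_; here; there)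
import Data.Vec.Properties as Vec
open import Function.Base using (id; _∘_)
open import Function.Bundles using (mk⇔; Equivalence)
open import Level using (0ℓ)
open import Relation.Binary.Construct.Add.Supremum.NonStrict ℚᵘ._≤_ using ([_])
import Relation.Binary.Construct.Add.Supremum.NonStrict _≤_ as ℕ∞
open import Relation.Binary.Construct.Closure.ReflexiveTransitive as Star
  using (Star; ε; _◅_; _◅◅_)
open import Relation.Binary.Core using (Rel)
open import Relation.Binary.Definitions using (Decidable)
open import Relation.Binary.PropositionalEquality as ≡
  using (_≡_; _≢_; refl; trans; cong; cong₂; subst; subst₂; module ≡-Reasoning)
open import Relation.Nullary.Construct.Add.Supremum using () renaming ([_] to fin)
open import Relation.Nullary.Decidable
  using (Dec; does; yes; no; map′; ¬?; _×-dec_; _⊎-dec_; _→-dec_; dec-true; dec-false; does-⇔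
        ; True; toWitness)
open import Relation.Nullary.Negation.Core using (contradiction)

-- Decidability of reachability

module _ {n : ℕ} {R : Rel (Fin n) 0ℓ} where

  -- Warshall's algorithm: Via k u v holds when a walk from u to v has all its
  -- inner vertices below k.
  Via : ℕ → Rel (Fin n) 0ℓ
  Via zero    u v = u ≡ v ⊎ R u v
  Via (suc k) u v = Via k u v ⊎ ∃[ w ] toℕ w ≡ k × Via k u w × Via k w v

  via? : Decidable R → ∀ k → Decidable (Via k)
  via? R? zero    u v = (u ≟ v) ⊎-dec R? u v
  via? R? (suc k) u v = via? R? k u v ⊎-dec
    any? λ w → (toℕ w ℕ.≟ k) ×-dec (via? R? k u w ×-dec via? R? k w v)

  via⇒star : ∀ k {u v} → Via k u v → Star R u v
  via⇒star zero    (inj₁ refl)            = ε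
  via⇒star zero    (inj₂ r)               = r ◅ ε
  via⇒star (suc k) (inj₁ p)               = via⇒star k p
  via⇒star (suc k) (inj₂ (_ , _ , p , q)) = via⇒star k p ◅◅ via⇒star k q

  via-base : ∀ k {u v} → u ≡ v ⊎ R u v → Via k u v
  via-base zero    b = b
  via-base (suc k) b = inj₁ (via-base k b)

  -- If `w` is the vertex numbered `k`, each half is cut at its visit to that vertex. Otherwise,
  -- when both halves visit it, the stretch between the two visits is dropped.
  via-trans : ∀ k {u w v} → toℕ w < k → Via k u w → Via k w v → Via k u v
  via-trans (suc k) {u} {w} {v} w<1+k p q with toℕ w ℕ.≟ k
  ... | yes w≡k = inj₂ (w , w≡k , into p , out q)
    where
    into : Via (suc k) u w → Via k u w
    into (inj₁ p) = p
    into (inj₂ (x , x≡k , p , _)) = subst (Via k u) (toℕ-injective (trans x≡k (≡.sym w≡k))) p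
    out : Via (suc k) w v → Via k w v
    out (inj₁ q) = q
    out (inj₂ (x , x≡k , _ , q)) =
      subst (λ y → Via k y v) (toℕ-injective (trans x≡k (≡.sym w≡k))) q
  ... | no w≢k = join p q
    where
    w<k = ℕ.≤∧≢⇒< (ℕ.≤-pred w<1+k) w≢k
    join : Via (suc k) u w → Via (suc k) w v → Via (suc k) u v
    join (inj₁ p) (inj₁ q) = inj₁ (via-trans k w<k p q)
    join (inj₁ p) (inj₂ (x , x≡k , q , r)) = inj₂ (x , x≡k , via-trans k w<k p q , r)
    join (inj₂ (x , x≡k , o , p)) (inj₁ q) = inj₂ (x , x≡k , o , via-trans k w<k p q)
    join (inj₂ (x , x≡k , o , _)) (inj₂ (y , y≡k , _ , r)) =
      inj₂ (x , x≡k , o , subst (λ z → Via k z v) (toℕ-injective (trans y≡k (≡.sym x≡k))) r)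

  star⇒via : ∀ {u v} → Star R u v → Via n u v
  star⇒via ε       = via-base n (inj₁ refl)
  star⇒via (r ◅ w) = via-trans n (toℕ<n _) (via-base n (inj₂ r)) (star⇒via w)

  star? : Decidable R → Decidable (Star R)
  star? R? u v = map′ (via⇒star n) star⇒via (via? R? n u v)

-- Invariants along walks

module _ {A : Set} {R : Rel A 0ℓ} where

  star-invariant : {B : Set} (f : A → B) → (∀ {x y} → R x y → f x ≡ f y) →
    ∀ {u v} → Star R u v → f u ≡ f v
  star-invariant f step = Star.fold (λ x y → f x ≡ f y) (λ r e → trans (step r) e) refl

  star-closed : (P : A → Set) → (∀ {x y} → R x y → P x → P y) →
    ∀ {u v} → Star R u v → P u → P v
  star-closed P step = Star.fold (λ x y → P x → P y) (λ r f → f ∘ step r) id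

  star-crossing : (side : A → Bool) → ∀ {u v} → Star R u v → side u ≡ true → side v ≡ false →
    ∃[ x ] ∃[ y ] R x y × side x ≡ true × side y ≡ false
  star-crossing side ε tu fu with () ← trans (≡.sym tu) fu
  star-crossing side (_◅_ {j = w} r p) tu fv with side w in eq
  ... | true  = star-crossing side p eq fv
  ... | false = _ , _ , r , tu , eq

-- Edge deletion, bridges, cuts and spanning trees

module _ {n : ℕ} where

  Joins : (a b : Fin n) → Rel (Fin n) 0ℓ
  Joins a b x y = (x ≡ a × y ≡ b) ⊎ (x ≡ b × y ≡ a)

  joins? : ∀ a b → Decidable (Joins a b)
  joins? a b x y = ((x ≟ a) ×-dec (y ≟ b)) ⊎-dec ((x ≟ b) ×-dec (y ≟ a))

  joins-sym : ∀ {a b x y} → Joins a b x y → Joins a b y x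
  joins-sym (inj₁ (p , q)) = inj₂ (q , p)
  joins-sym (inj₂ (p , q)) = inj₁ (q , p)

  delete : Graph n → Fin n → Fin n → Graph n
  delete H a b .Adj             = Delete H a b
  delete H a b .adj? x y        = adj? H x y ×-dec ¬? (joins? a b x y)
  delete H a b .sym (e , ¬j)    = H .sym e , ¬j ∘ joins-sym
  delete H a b .irrefl x≡y      = H .irrefl x≡y ∘ proj₁

  connected? : (H : Graph n) → Decidable (Star (Adj H))
  connected? H = star? (adj? H)

  module _ (H : Graph n) where

    star-sym : ∀ {x y} → Star (Adj H) x y → Star (Adj H) y x
    star-sym = Star.reverse (H .sym)

    -- A walk to `a` is followed until it is about to use the edge ab for the first time: it then
    -- stands at `a` or `b`.
    delete-endpoints : Connected H → ∀ a b w →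
      Star (Delete H a b) w a ⊎ Star (Delete H a b) w b
    delete-endpoints conn a b w = go (conn w a)
      where
      go : ∀ {w} → Star (Adj H) w a → Star (Delete H a b) w a ⊎ Star (Delete H a b) w b
      go ε = inj₁ ε
      go (_◅_ {w} {x} e p) with joins? a b w x
      ... | yes (inj₁ (refl , _)) = inj₁ ε
      ... | yes (inj₂ (refl , _)) = inj₂ ε
      ... | no ¬j = Sum.map ((e , ¬j) ◅_) ((e , ¬j) ◅_) (go p)

    delete-connected : Connected H → ∀ {a b} → Star (Delete H a b) a b → Connected (delete H a b)
    delete-connected conn {a} {b} ab u v = to-a u ◅◅ Star.reverse (delete H a b .sym) (to-a v)
      where
      to-a : ∀ w → Star (Delete H a b) w a
      to-a w = Sum.[ id , _◅◅ Star.reverse (delete H a b .sym) ab ] (delete-endpoints conn a b w)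

    open DecMembership (_≟_ {n}) using (_∈?_)

    mutual
      loop-erase : ∀ {u v} → Star (Adj H) u v → Path H u v
      loop-erase ε           = ε , [] ∷ []
      loop-erase (e ◅ w) = cons e (loop-erase w)

      cons : ∀ {u x v} → Adj H u x → Path H x v → Path H u v
      cons {u} e (p , unique) with u ∈? vertices H p
      ... | yes u∈p = suffix p unique u∈p
      ... | no  u∉p = e ◅ p , All.tabulate (λ x∈p u≡x → u∉p (subst (_∈ _) (≡.sym u≡x) x∈p)) ∷ unique

      suffix : ∀ {u x v} (p : Star (Adj H) x v) → Unique (vertices H p) → u ∈ vertices H p → Path H u v
      suffix ε       unique       (here refl) = ε , unique
      suffix (e ◅ p) unique       (here refl) = e ◅ p , unique
      suffix (e ◅ p) (_ ∷ unique) (there u∈p) = suffix p unique u∈p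

    vertices-reachable : ∀ {u v z} (p : Star (Adj H) u v) → z ∈ vertices H p → Star (Adj H) u z
    vertices-reachable ε       (here refl) = ε
    vertices-reachable (e ◅ p) (here refl) = ε
    vertices-reachable (e ◅ p) (there z∈p) = e ◅ vertices-reachable p z∈p

    start∈vertices : ∀ {u v} (p : Star (Adj H) u v) → u ∈ vertices H p
    start∈vertices ε       = here refl
    start∈vertices (_ ◅ _) = here refl

    avoids-first : ∀ {a b c x z y} → c ≡ a ⊎ c ≡ b → (e : Adj H x z) (p : Star (Adj H) z y) →
      c ∉ vertices H (e ◅ p) → ¬ Joins a b x z
    avoids-first {a} {b} {c} {x} {z} c∈ e p c∉ j with j
    ... | inj₁ (refl , refl) = Sum.[ c≢x , c≢z ] c∈
      where
      c≢x : c ≢ x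
      c≢x c≡x = c∉ (here c≡x)
      c≢z : c ≢ z
      c≢z refl = c∉ (there (start∈vertices p))
    ... | inj₂ (refl , refl) = Sum.[ c≢z , c≢x ] c∈
      where
      c≢x : c ≢ x
      c≢x c≡x = c∉ (here c≡x)
      c≢z : c ≢ z
      c≢z refl = c∉ (there (start∈vertices p))

    avoiding : ∀ {a b c x y} → c ≡ a ⊎ c ≡ b → (p : Star (Adj H) x y) → c ∉ vertices H p →
      Star (Delete H a b) x y
    avoiding c∈ ε       c∉ = ε
    avoiding c∈ (e ◅ p) c∉ = (e , avoids-first c∈ e p c∉) ◅ avoiding c∈ p (c∉ ∘ there)

  -- Cut-edges in a decidable form, through reachability instead of component counts;
  -- `bridge⇒cutEdge` makes the linear forest hypothesis available for them.
  IsBridge : Graph n → Rel (Fin n) 0ℓ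
  IsBridge H a b = Adj H a b × ¬ Star (Delete H a b) a b

  bridge? : (H : Graph n) → Decidable (IsBridge H)
  bridge? H a b = adj? H a b ×-dec ¬? (connected? (delete H a b) a b)

  bridge-sym : (H : Graph n) → ∀ {a b} → IsBridge H a b → IsBridge H b a
  bridge-sym H (e , ¬ab) = H .sym e ,
    ¬ab ∘ Star.reverse (λ (e , ¬j) → H .sym e , ¬j ∘ joins-sym ∘ Sum.swap)

  -- A Boolean `side` rather than a set of vertices, so that the sides given by several bridges can
  -- be combined into one label.
  record Cut (H : Graph n) (a b : Fin n) : Set where
    field
      side   : Fin n → Bool
      side-a : side a ≡ true
      side-b : side b ≡ false
      stable : ∀ {x y} → Adj H x y → ¬ Joins a b x y → side x ≡ side y

  bridge-cut : (H : Graph n) → ∀ {a b} → IsBridge H a b → Cut H a b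
  bridge-cut H {a} {b} (e , ¬ab) = record
    { side   = λ w → does (a⇝? w)
    ; side-a = dec-true (a⇝? a) ε
    ; side-b = dec-false (a⇝? b) ¬ab
    ; stable = λ {x} {y} e ¬j → does-⇔
        (mk⇔ (_◅◅ ((e , ¬j) ◅ ε)) (_◅◅ (delete H a b .sym (e , ¬j) ◅ ε)))
        (a⇝? x) (a⇝? y)
    }
    where
    a⇝? : ∀ w → Dec (Star (Delete H a b) a w)
    a⇝? = connected? (delete H a b) a

  _⊆ᴳ_ : Graph n → Graph n → Set
  H ⊆ᴳ K = ∀ {x y} → Adj H x y → Adj K x y

  Cherry : Graph n → (x y z : Fin n) → Set
  Cherry H x y z = IsBridge H y x × IsBridge H y z × x ≢ z

  cherry? : (H : Graph n) → ∀ x y z → Dec (Cherry H x y z)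
  cherry? H x y z = bridge? H y x ×-dec (bridge? H y z ×-dec ¬? (x ≟ z))

  -- `minimal` expresses acyclicity: every edge of the tree is a bridge of the tree.
  record SpanningTree (H : Graph n) : Set₁ where
    field
      tree      : Graph n
      ⊆graph    : tree ⊆ᴳ H
      connected : Connected tree
      minimal   : ∀ {a b} → Adj tree a b → ¬ Star (Delete tree a b) a b

  delete-mono : ∀ {H K : Graph n} → H ⊆ᴳ K → ∀ {a b} → delete H a b ⊆ᴳ delete K a b
  delete-mono H⊆K (e , ¬j) = H⊆K e , ¬j

  -- One pass over the pairs suffices: an edge kept because its deletion separates its ends stays
  -- necessary, as later deletions only shrink the graph.
  prune : (es : List (Fin n × Fin n)) (H : Graph n) → Connected H →
    Σ (Graph n) λ T → T ⊆ᴳ H × Connected T ×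
      ∀ {a b} → (a , b) ∈ es → Adj T a b → ¬ Star (Delete T a b) a b
  prune [] H conn = H , id , conn , λ ()
  prune ((a , b) ∷ es) H conn with connected? (delete H a b) a b
  ... | yes ab = let T , T⊆ , connT , min = prune es (delete H a b) (delete-connected H conn ab) in
    T , proj₁ ∘ T⊆ , connT , λ where
      (here refl) e → contradiction (inj₁ (refl , refl)) (proj₂ (T⊆ e))
      (there ∈es)   → min ∈es
  ... | no ¬ab = let T , T⊆ , connT , min = prune es H conn in
    T , T⊆ , connT , λ where
      (here refl) _ → ¬ab ∘ Star.map (delete-mono {T} {H} T⊆)
      (there ∈es)   → min ∈es

  spanningTree : (H : Graph n) → Connected H → SpanningTree H
  spanningTree H conn =
    let T , T⊆ , connT , min = prune (cartesianProduct (allFin n) (allFin n)) H conn in record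
    { tree      = T
    ; ⊆graph    = T⊆
    ; connected = connT
    ; minimal   = min (∈-cartesianProduct⁺ (∈-allFin _) (∈-allFin _))
    }

-- Colouring by a spanning tree, and conflict-free paths

module _ {n : ℕ} (G : Graph n) where

  vertices-map : (H : Graph n) (H⊆G : H ⊆ᴳ G) → ∀ {u v} (w : Star (Adj H) u v) →
    vertices G (Star.map H⊆G w) ≡ vertices H w
  vertices-map H H⊆G ε       = refl
  vertices-map H H⊆G (_ ◅ w) = cong (_ ∷_) (vertices-map H H⊆G w)

  vertices-++ : ∀ {u x y v} (p : Star (Adj G) u x) (e : Adj G x y) (q : Star (Adj G) y v) →
    vertices G (p ◅◅ (e ◅ q)) ≡ vertices G p ++ vertices G q
  vertices-++ ε       e q = refl
  vertices-++ (_ ◅ p) e q = cong (_ ∷_) (vertices-++ p e q)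

  colours-++ : ∀ {k} (c : EdgeColouring G k) → ∀ {u x v} (p : Star (Adj G) u x) (q : Star (Adj G) x v) →
    colours G c (p ◅◅ q) ≡ colours G c p ++ colours G c q
  colours-++ c ε       q = refl
  colours-++ c (e ◅ p) q = cong (_ ∷_) (colours-++ c p q)

  one : Fin 2
  one = suc zero

  -- `K` will be the spanning tree without the marked bridge.
  indicator : Graph n → EdgeColouring G 2
  indicator K .EdgeColouring.colour {x} {y} _ = if does (adj? K x y) then zero else one
  indicator K .EdgeColouring.symmetric {x} {y} _ _ = cong (if_then zero else one)
    (does-⇔ (mk⇔ (K .sym) (K .sym)) (adj? K x y) (adj? K y x))

  module Coloured (K : Graph n) where

    c : EdgeColouring G 2
    c = indicator K

    ones : ∀ {u v} → Star (Adj G) u v → ℕ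
    ones w = length (filter (one ≟_) (colours G c w))

    ones-inside : ∀ {u x v} (e : Adj G u x) (w : Star (Adj G) x v) → Adj K u x →
      ones (e ◅ w) ≡ ones w
    ones-inside {u} {x} e w k rewrite dec-true (adj? K u x) k = refl

    ones-outside : ∀ {u x v} (e : Adj G u x) (w : Star (Adj G) x v) → ¬ Adj K u x →
      ones (e ◅ w) ≡ suc (ones w)
    ones-outside {u} {x} e w ¬k rewrite dec-false (adj? K u x) ¬k = refl

    ones-++ : ∀ {u x v} (p : Star (Adj G) u x) (q : Star (Adj G) x v) →
      ones (p ◅◅ q) ≡ ones p + ones q
    ones-++ p q = begin
      ones (p ◅◅ q)
        ≡⟨ cong (length ∘ filter (one ≟_)) (colours-++ c p q) ⟩
      length (filter (one ≟_) (colours G c p ++ colours G c q))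
        ≡⟨ cong length (filter-++ (one ≟_) (colours G c p) _) ⟩
      length (filter (one ≟_) (colours G c p) ++ filter (one ≟_) (colours G c q))
        ≡⟨ length-++ (filter (one ≟_) (colours G c p)) ⟩
      ones p + ones q ∎
      where open ≡-Reasoning

    own-colour-once : (d : Fin 2) → length (filter (d ≟_) (d ∷ [])) ≡ 1
    own-colour-once zero       = refl
    own-colour-once (suc zero) = refl

  module _ (S : SpanningTree G) where

    open SpanningTree S

    -- s = t means that no bridge is marked.
    record Marking : Set where
      field
        s t     : Fin n
        side    : Fin n → Bool
        stable  : ∀ {x y} → Adj G x y → ¬ Joins s t x y → side x ≡ side y
        crosses : ∀ {x y} → Adj G x y → Joins s t x y → side x ≢ side y
        inTree  : ∀ {x y} → Adj G x y → Joins s t x y → Adj tree x y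
        covers  : ∀ {x y z} → IsBridge G x y → IsBridge G y z → x ≢ z →
                  Joins s t x y ⊎ Joins s t y z

    module _ (M : Marking) where

      open Marking M
      open Coloured (delete tree s t)

      ⇑ : ∀ {u v} → Star (Adj tree) u v → Star (Adj G) u v
      ⇑ = Star.map ⊆graph

      module _ {x z y} (e : Adj tree x z) (p : Star (Adj tree) z y)
               (unique : Unique (vertices tree (e ◅ p))) (j : Joins s t x z) where

        rest-avoids : Star (Delete tree s t) z y
        rest-avoids = avoiding tree (Sum.map proj₁ proj₁ j) p (Unique[x∷xs]⇒x∉xs unique)

        -- A path that starts with the marked edge does not return to its first vertex, hence does
        -- not use that edge again, so the side changes only there.
        crosses-once : side x ≢ side y
        crosses-once xy = crosses (⊆graph e) j
          (trans xy (≡.sym (star-invariant side (λ (e , ¬j) → stable (⊆graph e) ¬j) rest-avoids)))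

      ones-avoiding : ∀ {c x y} → c ≡ s ⊎ c ≡ t → (p : Star (Adj tree) x y) → c ∉ vertices tree p →
        ones (⇑ p) ≡ 0
      ones-avoiding c∈ ε c∉ = refl
      ones-avoiding c∈ (e ◅ p) c∉ =
        trans (ones-inside (⊆graph e) (⇑ p) (e , avoids-first tree c∈ e p c∉))
          (ones-avoiding c∈ p (c∉ ∘ there))

      ones-same : ∀ {x y} (p : Star (Adj tree) x y) → Unique (vertices tree p) →
        side x ≡ side y → ones (⇑ p) ≡ 0
      ones-same ε _ _ = refl
      ones-same (_◅_ {x} {z} e p) unique@(_ ∷ unique′) xy with joins? s t x z
      ... | yes j = contradiction xy (crosses-once e p unique j)
      ... | no ¬j = trans (ones-inside (⊆graph e) (⇑ p) (e , ¬j))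
        (ones-same p unique′ (trans (≡.sym (stable (⊆graph e) ¬j)) xy))

      ones-different : ∀ {x y} (p : Star (Adj tree) x y) → Unique (vertices tree p) →
        side x ≢ side y → ones (⇑ p) ≡ 1
      ones-different ε _ x≢x = contradiction refl x≢x
      ones-different (_◅_ {x} {z} e p) unique@(_ ∷ unique′) xy with joins? s t x z
      ... | yes j = trans (ones-outside (⊆graph e) (⇑ p) λ (_ , ¬j) → ¬j j)
        (cong suc (ones-avoiding (Sum.map proj₁ proj₁ j) p (Unique[x∷xs]⇒x∉xs unique)))
      ... | no ¬j = trans (ones-inside (⊆graph e) (⇑ p) (e , ¬j))
        (ones-different p unique′ (xy ∘ trans (stable (⊆graph e) ¬j)))

      -- Only ab joins the two sides of the tree, so a walk from `a` to `b` in G - ab changes sides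
      -- along an edge outside the tree. This edge replaces ab.
      detour : ∀ {a b u v} → Adj tree a b → ¬ IsBridge G a b →
        Star (Delete tree a b) u a → Star (Delete tree a b) b v → side u ≡ side v →
        Σ (Path G u v) (ConflictFree G c)
      detour {a} {b} {u} {v} e ¬bridge ua bv same
        with connected? (delete G a b) a b
      ... | no ¬ab = contradiction (⊆graph e , ¬ab) ¬bridge
      ... | yes ab =
        let x , y , (xy , ¬j) , τx , τy = star-crossing τ ab side-a side-b
            xy∉tree : ¬ Adj tree x y
            xy∉tree e = true≢false (trans (≡.sym τx) (trans (τ-stable e ¬j) τy))
            ux = ua ◅◅ Star.reverse (D .sym) (reach-a x τx)
            yv = reach-b y τy ◅◅ bv
            p , unique-p = loop-erase D ux
            q , unique-q = loop-erase D yv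
            τu = trans (D-invariant ux) τx
            τv = trans (≡.sym (D-invariant yv)) τy
            -- The marked bridge lies in the tree, so it is not xy and the ends of xy agree in
            -- `side`. With `same`, agreement of the ends of one half then implies it for the other
            -- half.
            side-xy = stable xy (λ j → xy∉tree (inTree xy j))
            p-same , q-same = sides τu ux τx yv τv side-xy
            P = Star.map proj₁ p
            Q = Star.map proj₁ q
            R = ⇑ P ◅◅ (xy ◅ ⇑ Q)
            vp = trans (vertices-map tree ⊆graph P) (vertices-map′ p)
            vq = trans (vertices-map tree ⊆graph Q) (vertices-map′ q)
            -- A vertex common to both halves would lie on both sides of ab.
            unique-R = subst Unique (≡.sym (trans (vertices-++ (⇑ P) xy (⇑ Q)) (cong₂ _++_ vp vq)))
              (++⁺ unique-p unique-q λ (z∈p , z∈q) → true≢false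
                (trans (≡.sym τu) (trans (D-invariant (vertices-reachable D p z∈p))
                  (trans (≡.sym (D-invariant (vertices-reachable D q z∈q))) τy))))
            unique-P = subst Unique (≡.sym (vertices-map′ p)) unique-p
            unique-Q = subst Unique (≡.sym (vertices-map′ q)) unique-q
        in (R , unique-R) , one ,
           (begin
             ones R                           ≡⟨ ones-++ (⇑ P) (xy ◅ ⇑ Q) ⟩
             ones (⇑ P) + ones (xy ◅ ⇑ Q)     ≡⟨ cong₂ _+_ (ones-same P unique-P p-same)
               (ones-outside xy (⇑ Q) (xy∉tree ∘ proj₁)) ⟩
             suc (ones (⇑ Q))                 ≡⟨ cong suc (ones-same Q unique-Q q-same) ⟩
             1                                ∎)
        where
        open ≡-Reasoning
        D = delete tree a b
        open Cut (bridge-cut tree (e , minimal e)) renaming (side to τ; stable to τ-stable)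
        true≢false : true ≢ false
        true≢false ()
        D-invariant : ∀ {x y} → Star (Adj D) x y → τ x ≡ τ y
        D-invariant = star-invariant τ λ (e , ¬j) → τ-stable e ¬j
        reach-a : ∀ x → τ x ≡ true → Star (Adj D) x a
        reach-a x τx with delete-endpoints tree connected a b x
        ... | inj₁ xa = xa
        ... | inj₂ xb = contradiction (trans (≡.sym τx) (trans (D-invariant xb) side-b)) true≢false
        reach-b : ∀ y → τ y ≡ false → Star (Adj D) y b
        reach-b y τy with delete-endpoints tree connected a b y
        ... | inj₁ ya = contradiction (trans (≡.sym side-a) (trans (≡.sym (D-invariant ya)) τy)) true≢false
        ... | inj₂ yb = yb
        vertices-map′ : ∀ {u v} (p : Star (Adj D) u v) → vertices tree (Star.map proj₁ p) ≡ vertices D p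
        vertices-map′ ε       = refl
        vertices-map′ (_ ◅ p) = cong (_ ∷_) (vertices-map′ p)
        -- Such a walk does not pass through `s`, because `τ` is constant along it; so it does not
        -- use the marked edge.
        away : ∀ {x y} → Star (Adj D) x y → τ x ≢ τ s → side x ≡ side y
        away ε _ = refl
        away (_◅_ {x} {z} (e , ¬j) p) ≢τs =
          trans (stable (⊆graph e) λ where
              (inj₁ (refl , _)) → ≢τs refl
              (inj₂ (_ , refl)) → ≢τs (τ-stable e ¬j))
            (away p (≢τs ∘ trans (τ-stable e ¬j)))
        -- The marked edge has both endpoints on one side of ab, so the part of the
        -- detour on the other side avoids it.
        sides : ∀ {x y} → τ u ≡ true → Star (Adj D) u x → τ x ≡ true →
          Star (Adj D) y v → τ v ≡ false → side x ≡ side y → side u ≡ side x × side y ≡ side v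
        sides τu ux τx yv τv xy with τ s in τs
        ... | true  = trans same (trans (≡.sym side-yv) (≡.sym xy)) , side-yv
          where side-yv = away yv λ e → true≢false (trans (≡.sym τs)
                  (trans (≡.sym e) (trans (D-invariant yv) τv)))
        ... | false = side-ux , trans (≡.sym xy) (trans (≡.sym side-ux) same)
          where side-ux = away ux λ e → true≢false (trans (≡.sym τu) (trans e τs))

      conflictFreeConnected : ConflictFreeConnected G c
      conflictFreeConnected u v u≢v with loop-erase tree (connected u v)
      ... | ε , _ = contradiction refl u≢v
      ... | P@(e ◅ ε) , unique =
        (⇑ P , subst Unique (≡.sym (vertices-map tree ⊆graph P)) unique) ,
        colour c (⊆graph e) , own-colour-once (colour c (⊆graph e))
      -- For ends on the same side the first two edges decide. If one of them is not a bridge, it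
      -- allows a detour; if both are, the marked bridge is one of them and the ends lie on
      -- different sides.
      ... | P@(_◅_ {j = x} e (_◅_ {j = y} f p)) , unique@(u∉ ∷ unique′@(x∉ ∷ _))
        with side u Bool.≟ side v
      ...   | no different =
        (⇑ P , subst Unique (≡.sym (vertices-map tree ⊆graph P)) unique) , one , ones-different P unique different
      ...   | yes same with bridge? G u x | bridge? G x y
      ...     | no ¬ux | _ = detour e ¬ux ε
        (avoiding tree (inj₁ refl) (f ◅ p) (Unique[x∷xs]⇒x∉xs unique)) same
      ...     | yes _ | no ¬xy = detour f ¬xy
        ((e , Sum.[ (λ (u≡x , _) → All.lookup u∉ (here refl) u≡x)
                  , (λ (u≡y , _) → All.lookup u∉ (there (start∈vertices tree p)) u≡y) ]) ◅ ε)
        (avoiding tree (inj₁ refl) p (Unique[x∷xs]⇒x∉xs unique′)) same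
      ...     | yes ux | yes xy with joins? s t u x
      ...       | yes j = contradiction same (crosses-once e (f ◅ p) unique j)
      ...       | no ¬j with covers ux xy (All.lookup u∉ (there (start∈vertices tree p)))
      ...         | inj₁ j = contradiction j ¬j
      ...         | inj₂ j = contradiction (trans (≡.sym (stable (⊆graph e) ¬j)) same)
                               (crosses-once f p unique′ j)

-- The lower bound of two colours

module _ {n : ℕ} (G : Graph n) where

  -- Without colours no path is conflict-free, and with a single colour only paths of one edge are.
  -- Either way any two distinct vertices would be adjacent.
  cfc-lower : ¬ Complete G → ∀ j → Σ (EdgeColouring G j) (ConflictFreeConnected G) → 2 ≤ j
  cfc-lower ¬complete 0 (_ , cfc) = contradiction (λ u v u≢v → no-colour (cfc u v u≢v)) ¬complete
    where
    no-colour : ∀ {c : EdgeColouring G 0} {u v} → Σ (Path G u v) (ConflictFree G c) → Adj G u v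
    no-colour (_ , () , _)
  cfc-lower ¬complete 1 (c , cfc) = contradiction (λ u v u≢v → single (cfc u v u≢v) u≢v) ¬complete
    where
    length-filter : (a : Fin 1) (cs : List (Fin 1)) → length (filter (a ≟_) cs) ≡ length cs
    length-filter zero []          = refl
    length-filter zero (zero ∷ cs) = cong suc (length-filter zero cs)
    single : ∀ {u v} → Σ (Path G u v) (ConflictFree G c) → u ≢ v → Adj G u v
    single ((ε , _) , _) u≢u = contradiction refl u≢u
    single ((e ◅ ε , _) , _) _ = e
    single ((e ◅ f ◅ p , _) , a , once) _
      with () ← trans (≡.sym (length-filter a (colours G c (e ◅ f ◅ p)))) once
  cfc-lower ¬complete (suc (suc j)) _ = s≤s (s≤s z≤n)

-- Bridges as cut-edges, and the choice of the marked bridge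

pathEdge-degree : ∀ {m} {i j k l : Fin m} → PathEdge i j → PathEdge i k → PathEdge i l →
  k ≡ j ⊎ l ≡ j ⊎ k ≡ l
pathEdge-degree = λ where
    (inj₁ j) (inj₁ k) _        → inj₁ (toℕ-injective (trans k (≡.sym j)))
    (inj₁ j) (inj₂ k) (inj₁ l) → inj₂ (inj₁ (toℕ-injective (trans l (≡.sym j))))
    (inj₁ j) (inj₂ k) (inj₂ l) → inj₂ (inj₂ (below k l))
    (inj₂ j) (inj₁ k) (inj₁ l) → inj₂ (inj₂ (toℕ-injective (trans k (≡.sym l))))
    (inj₂ j) (inj₁ k) (inj₂ l) → inj₂ (inj₁ (below l j))
    (inj₂ j) (inj₂ k) _        → inj₁ (below k j)
  where
  below : ∀ {m} {i j k : Fin m} → toℕ i ≡ suc (toℕ j) → toℕ i ≡ suc (toℕ k) → j ≡ k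
  below j k = toℕ-injective (ℕ.suc-injective (trans (≡.sym j) k))

module _ {n : ℕ} (G : Graph n) (conn : Connected G) where

  -- The component count rises from 1 to exactly 2: after the deletion every vertex still reaches
  -- `a` or `b`, and `side` tells which.
  bridge⇒cutEdge : ∀ {a b} → IsBridge G a b → CutEdge G a b
  bridge⇒cutEdge {a} {b} ab@(e , _) = e , 1 , 2 , whole , split , s≤s (s≤s z≤n)
    where
    open Cut (bridge-cut G ab)
    whole : HasComponents (Adj G) 1
    whole = (λ _ → zero) , (λ { zero → a , λ _ → refl }) ,
      λ u v → mk⇔ (λ _ → conn u v) (λ _ → refl)
    invariant : ∀ {u v} → Star (Delete G a b) u v → side u ≡ side v
    invariant = star-invariant side λ (e , ¬j) → stable e ¬j
    label : Fin n → Fin 2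
    label w = if side w then zero else suc zero
    label-a : label a ≡ zero
    label-a rewrite side-a = refl
    label-b : label b ≡ suc zero
    label-b rewrite side-b = refl
    label-invariant : ∀ {u v} → Star (Delete G a b) u v → label u ≡ label v
    label-invariant = cong (if_then zero else suc zero) ∘ invariant
    join : ∀ u v → label u ≡ label v → Star (Delete G a b) u v
    join u v eq with delete-endpoints G conn a b u | delete-endpoints G conn a b v
    ... | inj₁ ua | inj₁ va = ua ◅◅ star-sym (delete G a b) va
    ... | inj₂ ub | inj₂ vb = ub ◅◅ star-sym (delete G a b) vb
    ... | inj₁ ua | inj₂ vb with () ← trans (≡.sym (trans (label-invariant ua) label-a))
                                        (trans eq (trans (label-invariant vb) label-b))
    ... | inj₂ ub | inj₁ va with () ← trans (≡.sym (trans (label-invariant ub) label-b))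
                                        (trans eq (trans (label-invariant va) label-a))
    split : HasComponents (Delete G a b) 2
    split = label ,
      (λ { zero → a , λ { refl → label-a } ; (suc zero) → b , λ { refl → label-b } }) ,
      λ u v → mk⇔ (join u v) label-invariant

  module _ (linear : LinearForest (C G)) where

    -- The component of `b` in `C G` is a path, where `b` has at most two neighbours. Hence every
    -- cherry centred at `b` contains the given bridge bw.
    bridges-at : ∀ {b w x z} → IsBridge G b w → IsBridge G b x → IsBridge G b z → x ≢ z →
      x ≡ w ⊎ z ≡ w
    bridges-at {b} {w} bw bx bz x≢z
      with m , p , _ , component , edges ← linear b (w , bridge⇒cutEdge bw)
      with i , refl ← Equivalence.to (component b) ε
      with j , refl ← Equivalence.to (component w) (bridge⇒cutEdge bw ◅ ε)
         | k , refl ← Equivalence.to (component _) (bridge⇒cutEdge bx ◅ ε)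
         | l , refl ← Equivalence.to (component _) (bridge⇒cutEdge bz ◅ ε)
      with pathEdge-degree (Equivalence.to (edges i j) (bridge⇒cutEdge bw))
          (Equivalence.to (edges i k) (bridge⇒cutEdge bx))
          (Equivalence.to (edges i l) (bridge⇒cutEdge bz))
    ... | inj₁ k≡j        = inj₁ (cong p k≡j)
    ... | inj₂ (inj₁ l≡j) = inj₂ (cong p l≡j)
    ... | inj₂ (inj₂ k≡l) = contradiction (cong p k≡l) x≢z

  module _ (S : SpanningTree G) where

    open SpanningTree S

    bridge∈tree : ∀ {a b} → IsBridge G a b → Adj tree a b
    bridge∈tree {a} {b} (_ , ¬ab) with adj? tree a b
    ... | yes e = e
    ... | no ¬e = contradiction (Star.map (λ e → ⊆graph e , avoid e) (connected a b)) ¬ab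
      where
      avoid : ∀ {x y} → Adj tree x y → ¬ Joins a b x y
      avoid e (inj₁ (refl , refl)) = ¬e e
      avoid e (inj₂ (refl , refl)) = ¬e (tree .sym e)

    markBridge : ∀ {a b} → IsBridge G a b →
      (∀ {x y z} → Cherry G x y z → Joins a b x y ⊎ Joins a b y z) → Marking G S
    markBridge {a} {b} ab covers = record
      { s = a ; t = b ; side = side ; stable = stable
      ; crosses = λ where
          _ (inj₁ (refl , refl)) eq → distinct (trans (≡.sym side-a) (trans eq side-b))
          _ (inj₂ (refl , refl)) eq → distinct (trans (≡.sym side-a) (trans (≡.sym eq) side-b))
      ; inTree = λ where
          _ (inj₁ (refl , refl)) → bridge∈tree ab
          _ (inj₂ (refl , refl)) → tree .sym (bridge∈tree ab)
      ; covers = λ xy yz x≢z → covers (bridge-sym G xy , yz , x≢z)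
      }
      where
      open Cut (bridge-cut G ab)
      distinct : true ≢ false
      distinct ()

    -- As G has no loops, no edge joins `r` to itself, and the conditions on the marked edge hold
    -- vacuously.
    markNone : Fin n → (∀ {x y z} → ¬ Cherry G x y z) → Marking G S
    markNone r none = record
      { s = r ; t = r ; side = λ _ → true ; stable = λ _ _ → refl
      ; crosses = λ e j → contradiction e (loop j)
      ; inTree = λ e j → contradiction e (loop j)
      ; covers = λ xy yz x≢z → contradiction (bridge-sym G xy , yz , x≢z) none
      }
      where
      loop : ∀ {x y} → Joins r r x y → ¬ Adj G x y
      loop (inj₁ (refl , refl)) = G .irrefl refl
      loop (inj₂ (refl , refl)) = G .irrefl refl

    -- If all cherries share a centre, any bridge at it that belongs to a cherry lies in all of
    -- them. If there are two centres, the bridge between them is marked, and a third centre is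
    -- impossible.
    marking : Fin n → LinearForest (C G) →
      (∀ {u v x₁ x₂ y₁ y₂} → u ≢ v → ¬ IsBridge G u v → Cherry G x₁ u x₂ → ¬ Cherry G y₁ v y₂) →
      Marking G S
    marking r linear centres-joined with any? (λ b → any? λ a → any? λ c → cherry? G a b c)
    ... | no none = markNone r λ ch → none (_ , _ , _ , ch)
    ... | yes (b , a , c , ch@(ba , bc , a≢c))
      with any? (λ b′ → ¬? (b ≟ b′) ×-dec any? λ a′ → any? λ c′ → cherry? G a′ b′ c′)
    ...   | no unique = markBridge ba covers
      where
      covers : ∀ {x y z} → Cherry G x y z → Joins b a x y ⊎ Joins b a y z
      covers {x} {y} {z} xyz@(yx , yz , x≢z) with b ≟ y
      ... | no b≢y = contradiction (y , b≢y , x , z , xyz) unique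
      ... | yes refl = Sum.map (λ { refl → inj₂ (refl , refl) }) (λ { refl → inj₁ (refl , refl) })
                         (bridges-at linear ba yx yz x≢z)
    ...   | yes (b′ , b≢b′ , a′ , c′ , ch′) with bridge? G b b′
    ...     | no ¬bb′ = contradiction ch′ (centres-joined b≢b′ ¬bb′ ch)
    ...     | yes bb′ = markBridge bb′ covers
      where
      covers : ∀ {x y z} → Cherry G x y z → Joins b b′ x y ⊎ Joins b b′ y z
      covers {x} {y} {z} xyz@(yx , yz , x≢z) with b ≟ y | b′ ≟ y
      ... | yes refl | _ = Sum.map (λ { refl → inj₂ (refl , refl) }) (λ { refl → inj₁ (refl , refl) })
                             (bridges-at linear bb′ yx yz x≢z)
      ... | no _ | yes refl = Sum.map (λ { refl → inj₁ (refl , refl) }) (λ { refl → inj₂ (refl , refl) })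
                             (bridges-at linear (bridge-sym G bb′) yx yz x≢z)
      ... | no b≢y | no b′≢y with bridge? G b y | bridge? G b′ y
      ...   | no ¬by | _ = contradiction xyz (centres-joined b≢y ¬by ch)
      ...   | yes _ | no ¬b′y = contradiction xyz (centres-joined b′≢y ¬b′y ch′)
      -- A third centre `y` would be joined to both `b` and `b′`, and the walk b, y, b′ would bypass
      -- the bridge bb′.
      ...   | yes (by , _) | yes (b′y , _) = contradiction
        ((by , Sum.[ b′≢y ∘ ≡.sym ∘ proj₂ , b≢b′ ∘ proj₁ ]) ◅
         (G .sym b′y , Sum.[ b≢y ∘ ≡.sym ∘ proj₁ , b′≢y ∘ ≡.sym ∘ proj₁ ]) ◅ ε)
        (proj₂ bb′)

-- Lists without repetition as vertex subsets

lookup-injective : ∀ {A : Set} {xs : List A} → Unique xs → ∀ {i j} → lookup xs i ≡ lookup xs j → i ≡ j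
lookup-injective (_ ∷ _)  {zero}  {zero}  _  = refl
lookup-injective (x∉ ∷ _) {zero}  {suc j} eq = contradiction eq (All.lookup x∉ (∈-lookup j))
lookup-injective (x∉ ∷ _) {suc i} {zero}  eq = contradiction (≡.sym eq) (All.lookup x∉ (∈-lookup i))
lookup-injective (_ ∷ u)  {suc i} {suc j} eq = cong suc (lookup-injective u eq)

unique⇒length≤ : ∀ {n} {xs : List (Fin n)} → Unique xs → length xs ≤ n
unique⇒length≤ unique = injective⇒≤ (lookup-injective unique)

module _ {n : ℕ} where

  fromList : List (Fin n) → Subset n
  fromList []       = Subset.⊥
  fromList (x ∷ xs) = ⁅ x ⁆ ∪ fromList xs

  ∈-fromList⁺ : ∀ {x xs} → x ∈ xs → x Subset.∈ fromList xs
  ∈-fromList⁺ (here refl)  = Subset.x∈p∪q⁺ (inj₁ (Subset.x∈⁅x⁆ _))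
  ∈-fromList⁺ (there x∈xs) = Subset.x∈p∪q⁺ (inj₂ (∈-fromList⁺ x∈xs))

  ∈-fromList⁻ : ∀ {x} xs → x Subset.∈ fromList xs → x ∈ xs
  ∈-fromList⁻ []       x∈ = contradiction x∈ Subset.∉⊥
  ∈-fromList⁻ (y ∷ xs) x∈ with Subset.x∈p∪q⁻ ⁅ y ⁆ (fromList xs) x∈
  ... | inj₁ x∈y  = here (Subset.x∈⁅y⁆⇒x≡y y x∈y)
  ... | inj₂ x∈xs = there (∈-fromList⁻ xs x∈xs)

∣⁅x⁆∪p∣ : ∀ {n} (x : Fin n) (p : Subset n) → x Subset.∉ p → ∣ ⁅ x ⁆ ∪ p ∣ ≡ suc ∣ p ∣
∣⁅x⁆∪p∣ zero    (false ∷ p) _   = cong (suc ∘ ∣_∣) (Subset.∪-identityˡ p)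
∣⁅x⁆∪p∣ zero    (true ∷ p)  x∉p = contradiction here x∉p
∣⁅x⁆∪p∣ (suc x) (false ∷ p) x∉p = ∣⁅x⁆∪p∣ x p (x∉p ∘ there)
∣⁅x⁆∪p∣ (suc x) (true ∷ p)  x∉p = cong suc (∣⁅x⁆∪p∣ x p (x∉p ∘ there))

∣fromList∣ : ∀ {n} {xs : List (Fin n)} → Unique xs → ∣ fromList xs ∣ ≡ length xs
∣fromList∣ {n} {[]}     _ = Subset.∣⊥∣≡0 n
∣fromList∣ {n} {x ∷ xs} unique@(_ ∷ unique′) =
  trans (∣⁅x⁆∪p∣ x (fromList xs) (Unique[x∷xs]⇒x∉xs unique ∘ ∈-fromList⁻ xs))
    (cong suc (∣fromList∣ unique′))

-- Degree sums of vertices far apart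

module _ {n : ℕ} (G : Graph n) where

  neighbours : Fin n → List (Fin n)
  neighbours v = filter (adj? G v) (allFin n)

  neighbours-unique : ∀ v → Unique (neighbours v)
  neighbours-unique v = filter⁺ (adj? G v) (allFin⁺ n)

  ∈-neighbours⁺ : ∀ {v w} → Adj G v w → w ∈ neighbours v
  ∈-neighbours⁺ e = ∈-filter⁺ (adj? G _) (∈-allFin _) e

  ∈-neighbours⁻ : ∀ {v w} → w ∈ neighbours v → Adj G v w
  ∈-neighbours⁻ {v} = proj₂ ∘ ∈-filter⁻ (adj? G v) {xs = allFin n}

  δ≤degree : ∀ v → δ G ≤ degree G v
  δ≤degree v = All.lookup (minℕ≤xs n (map (degree G) (allFin n))) (∈-map⁺ (degree G) (∈-allFin v))

  -- Among three distinct neighbours at most two are excluded; `s` and `t` may coincide.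
  third-neighbour : ∀ {v} → 3 ≤ degree G v → ∀ s t → ∃[ z ] Adj G v z × z ≢ s × z ≢ t
  third-neighbour {v} 3≤d s t = go 3≤d (neighbours-unique v) ∈-neighbours⁻
    where
    go : ∀ {xs} → 3 ≤ length xs → Unique xs → (∀ {w} → w ∈ xs → Adj G v w) →
      ∃[ z ] Adj G v z × z ≢ s × z ≢ t
    go {x ∷ y ∷ z ∷ _} (s≤s (s≤s (s≤s _))) ((x≢y ∷ x≢z ∷ _) ∷ (y≢z ∷ _) ∷ _) adj
      with x ≟ s | x ≟ t | y ≟ s | y ≟ t
    ... | no x≢s | no x≢t | _ | _ = x , adj (here refl) , x≢s , x≢t
    ... | _ | _ | no y≢s | no y≢t = y , adj (there (here refl)) , y≢s , y≢t
    ... | yes refl | _ | yes refl | _ = contradiction refl x≢y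
    ... | _ | yes refl | _ | yes refl = contradiction refl x≢y
    ... | yes refl | _ | _ | yes refl = z , adj (there (there (here refl))) , x≢z ∘ ≡.sym , y≢z ∘ ≡.sym
    ... | _ | yes refl | yes refl | _ = z , adj (there (there (here refl))) , y≢z ∘ ≡.sym , x≢z ∘ ≡.sym

  -- The two lists of summands come from lists of vertices with the same elements and no
  -- repetitions, hence from permutations of each other.
  degreeSum-fromList : ∀ {xs} → Unique xs → degreeSum G (fromList xs) ≡ sum (map (degree G) xs)
  degreeSum-fromList {xs} unique = sum-↭ (↭.map⁺ (degree G) (∼bag⇒↭ (unique∧set⇒bag
    (filter⁺ (Subset._∈? fromList xs) (allFin⁺ n)) unique
    (mk⇔ (∈-fromList⁻ xs ∘ proj₂ ∘ ∈-filter⁻ (Subset._∈? fromList xs) {xs = allFin n})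
         (∈-filter⁺ (Subset._∈? fromList xs) (∈-allFin _) ∘ ∈-fromList⁺)))))

  -- Distance at least three, as disjointness of closed neighbourhoods.
  Far : Fin n → Fin n → Set
  Far x y = Disjoint (x ∷ neighbours x) (y ∷ neighbours y)

  far⇒≢ : ∀ {x y} → Far x y → x ≢ y
  far⇒≢ far refl = far (here refl , here refl)

  far-independent : ∀ {xs} → AllPairs Far xs → Independent G (fromList xs)
  far-independent {xs} far u v u∈ v∈ = go far (∈-fromList⁻ xs u∈) (∈-fromList⁻ xs v∈)
    where
    go : ∀ {xs} → AllPairs Far xs → u ∈ xs → v ∈ xs → ¬ Adj G u v
    go (_ ∷ _)   (here refl) (here refl) e = G .irrefl refl e
    go (far ∷ _) (here refl) (there v∈)  e = All.lookup far v∈ (there (∈-neighbours⁺ e) , here refl)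
    go (far ∷ _) (there u∈)  (here refl) e =
      All.lookup far u∈ (there (∈-neighbours⁺ (G .sym e)) , here refl)
    go (_ ∷ far) (there u∈)  (there v∈)  e = go far u∈ v∈ e

  σ≤degreeSum : ∀ {xs} → AllPairs Far xs → σ G (length xs) ℕ∞.≤⁺ fin (sum (map (degree G) xs))
  σ≤degreeSum {xs} far = subst (λ d → σ G (length xs) ℕ∞.≤⁺ fin d) (degreeSum-fromList unique)
    (All.lookup (min≤xs _ _) (∈-map⁺ (fin ∘ degreeSum G)
      (∈-filter⁺ (λ S → independent? G S ×-dec (∣ S ∣ ℕ.≟ length xs)) (∈-subsets (fromList xs))
        (far-independent far , ∣fromList∣ unique))))
    where
    unique : Unique xs
    unique = AllPairs.map far⇒≢ far

  far⇒Σdegree≤ : ∀ {xs} → AllPairs Far xs → sum (map (suc ∘ degree G) xs) ≤ n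
  far⇒Σdegree≤ {xs} far = subst (_≤ n) (length-concat xs) (unique⇒length≤
    (concat⁺ (All.map⁺ (All.tabulate λ _ → closed-unique _)) (AllPairs.map⁺ far)))
    where
    closed : Fin n → List (Fin n)
    closed v = v ∷ neighbours v
    closed-unique : ∀ v → Unique (closed v)
    closed-unique v = All.tabulate (λ w∈ v≡w → G .irrefl v≡w (∈-neighbours⁻ w∈)) ∷ neighbours-unique v
    length-concat : ∀ xs → length (concat (map closed xs)) ≡ sum (map (suc ∘ degree G) xs)
    length-concat []       = refl
    length-concat (x ∷ xs) = trans (length-++ (closed x)) (cong (λ m → suc (degree G x) + m) (length-concat xs))

-- Arithmetic with the bound on σ₄

≤∞-finite : ∀ {q x s} → q ≤∞ x → x ℕ∞.≤⁺ fin s → q ℚᵘ.≤ + s / 1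
≤∞-finite {x = fin k} [ q≤k ] ℕ∞.[ k≤s ] =
  ℚᵘ.≤-trans q≤k (ℚᵘ.*≤* (ℤ.*-monoʳ-≤-nonNeg (+ 1) (ℤ.+≤+ k≤s)))

clear-denominator : ∀ {a b s} → (+ a - + b) / 5 ℚᵘ.≤ + s / 1 → a ≤ s * 5 + b
clear-denominator {a} {b} {s} (ℚᵘ.*≤* le) = ℤ.drop‿+≤+ (begin
  + a                      ≡⟨ ℤ.+-identityʳ (+ a) ⟨
  + a ℤ.+ + 0              ≡⟨ cong (λ i → + a ℤ.+ i) (ℤ.+-inverseˡ (+ b)) ⟨
  + a ℤ.+ (ℤ.- + b ℤ.+ + b) ≡⟨ ℤ.+-assoc (+ a) (ℤ.- + b) (+ b) ⟨
  (+ a - + b) ℤ.+ + b      ≤⟨ ℤ.+-monoˡ-≤ (+ b)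
    (subst₂ ℤ._≤_ (ℤ.*-identityʳ (+ a - + b)) (≡.sym (ℤ.pos-* s 5)) le) ⟩
  + (s * 5 + b)            ∎)
  where open ℤ.≤-Reasoning

module _ {n : ℕ} (G : Graph n) (σ-bound : (+ (4 * n) - + 19) / 5 ≤∞ σ G 4) where

  four-far : ∀ {a b c d} → AllPairs (Far G) (a ∷ b ∷ c ∷ d ∷ []) →
    4 * n ≤ sum (map (degree G) (a ∷ b ∷ c ∷ d ∷ [])) * 5 + 19
  four-far far = clear-denominator (≤∞-finite σ-bound (σ≤degreeSum G far))

  -- Let D be the sum of the five degrees. Disjointness gives 20(D + 5) ≤ 20n. Each degree occurs in
  -- four of the five sums of four, so adding the bounds gives 20n ≤ 20D + 5 · 19, whence 100 ≤ 95.
  five-far : ∀ {a b c d e} → ¬ AllPairs (Far G) (a ∷ b ∷ c ∷ d ∷ e ∷ [])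
  five-far {a} {b} {c} {d} {e}
    far@((ab ∷ ac ∷ ad ∷ ae ∷ []) ∷ far-a@((bc ∷ bd ∷ be ∷ []) ∷
      far-b@((cd ∷ ce ∷ []) ∷ far-c@((de ∷ []) ∷ _)))) =
    contradiction total (ℕ.<⇒≱ (ℕ.+-monoʳ-< _ (s≤s (ℕ.m≤m+n 95 4))))
    where
    open +-*-Solver
    total = begin
      20 * (deg a + (deg b + (deg c + (deg d + deg e)))) + 100
        ≡⟨ solve 5 (λ a b c d e →
             con 20 :* (a :+ (b :+ (c :+ (d :+ e)))) :+ con 100 := con 20 :* (con 1 :+ a :+ (con 1 :+ b :+ (con 1 :+ c :+ (con 1 :+ d :+ (con 1 :+ e :+ con 0))))))
             refl (deg a) (deg b) (deg c) (deg d) (deg e) ⟩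
      20 * sum (map (suc ∘ deg) (a ∷ b ∷ c ∷ d ∷ e ∷ []))
        ≤⟨ ℕ.*-monoʳ-≤ 20 (far⇒Σdegree≤ G far) ⟩
      20 * n
        ≡⟨ solve 1 (λ n →
             con 20 :* n := con 4 :* n :+ (con 4 :* n :+ (con 4 :* n :+ (con 4 :* n :+ con 4 :* n)))) refl n ⟩
      4 * n + (4 * n + (4 * n + (4 * n + 4 * n)))
        ≤⟨ ℕ.+-mono-≤ (four-far far-a) (ℕ.+-mono-≤ (four-far ((ac ∷ ad ∷ ae ∷ []) ∷ far-b))
           (ℕ.+-mono-≤ (four-far ((ab ∷ ad ∷ ae ∷ []) ∷ (bd ∷ be ∷ []) ∷ far-c))
           (ℕ.+-mono-≤ (four-far ((ab ∷ ac ∷ ae ∷ []) ∷ (bc ∷ be ∷ []) ∷ (ce ∷ []) ∷ [] ∷ []))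
           (four-far ((ab ∷ ac ∷ ad ∷ []) ∷ (bc ∷ bd ∷ []) ∷ (cd ∷ []) ∷ [] ∷ []))))) ⟩
      omit (b ∷ c ∷ d ∷ e ∷ []) + (omit (a ∷ c ∷ d ∷ e ∷ []) + (omit (a ∷ b ∷ d ∷ e ∷ []) +
        (omit (a ∷ b ∷ c ∷ e ∷ []) + omit (a ∷ b ∷ c ∷ d ∷ []))))
        ≡⟨ solve 5 (λ a b c d e →
             let s = λ w x y z → (w :+ (x :+ (y :+ (z :+ con 0)))) :* con 5 :+ con 19 in
             s b c d e :+ (s a c d e :+ (s a b d e :+ (s a b c e :+ s a b c d)))
               := con 20 :* (a :+ (b :+ (c :+ (d :+ e)))) :+ con 95)
             refl (deg a) (deg b) (deg c) (deg d) (deg e) ⟩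
      20 * (deg a + (deg b + (deg c + (deg d + deg e)))) + 95 ∎
      where
      open ℕ.≤-Reasoning
      deg = degree G
      omit : List (Fin n) → ℕ
      omit xs = sum (map deg xs) * 5 + 19

-- Private vertices in the pieces left by edge deletions

_≟ᵛ_ : ∀ {k} (xs ys : Vec Bool k) → Dec (xs ≡ ys)
_≟ᵛ_ = Vec.≡-dec Bool._≟_

-- Combinatorics of the pieces left when the edges joining certain sites are
-- deleted.  The piece of site i is L i; Selects i X Y makes sure that a
-- neighbour of site i outside X lies in the piece of i and is no site, provided
-- that no site in Y coincides with i.
module Pieces {m k : ℕ} (L : Fin m → Vec Bool k) (arms : List (Fin m × Fin m)) where

  open DecMembership (_≟_ {m}) using (_∈?_)

  -- Sites may coincide, but only if their labels agree. The condition ensures that the edge from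
  -- site `i` to the chosen neighbour is not the arm pq read from p to q.
  Blocked : (i : Fin m) (X Y : List (Fin m)) (p q : Fin m) → Set
  Blocked i X Y p q = L p ≡ L i → q ∈ X ⊎ p ∈ Y

  Selects : (i : Fin m) (X Y : List (Fin m)) → Set
  Selects i X Y = (∀ j → L j ≡ L i → j ≡ i ⊎ j ∈ X) ×
    All (λ (p , q) → Blocked i X Y p q × Blocked i X Y q p) arms

  selects? : ∀ i X Y → Dec (Selects i X Y)
  selects? i X Y = all? (λ j → (L j ≟ᵛ L i) →-dec ((j ≟ i) ⊎-dec (j ∈? X))) ×-dec
    All.all? (λ (p , q) → blocked? p q ×-dec blocked? q p) arms
    where
    blocked? : ∀ p q → Dec (Blocked i X Y p q)
    blocked? p q = (L p ≟ᵛ L i) →-dec ((q ∈? X) ⊎-dec (p ∈? Y))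

  Different : List (Fin m) → Set
  Different = AllPairs (λ i j → L i ≢ L j)

  different? : ∀ is → Dec (Different is)
  different? = allPairs? λ i j → ¬? (L i ≟ᵛ L j)

  module _ {n : ℕ} (G : Graph n) (site : Fin m → Fin n) (label : Fin n → Vec Bool k)
    (label-site : ∀ i → label (site i) ≡ L i)
    (stable : ∀ {x y} → Adj G x y → All (λ (p , q) → ¬ Joins (site p) (site q) x y) arms →
              label x ≡ label y) where

    record Private (i : Fin m) : Set where
      field
        vertex : Fin n
        located : label vertex ≡ L i
        closed : ∀ {w} → Adj G vertex w → label w ≡ L i

    open Private

    -- The edge to `z` is no arm, so `z` lies in the piece of site `i`. The sites there are
    -- excluded, so `z` is no site, none of its edges is an arm, and its neighbours stay in the
    -- piece. The finite condition `ok` is settled by evaluation.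
    private-vertex : ∀ i X Y → {True (selects? i X Y)} → ∀ {z} → Adj G (site i) z →
      All (λ j → z ≢ site j) X → All (λ j → site i ≢ site j) Y → Private i
    private-vertex i X Y {ok} {z} e z∉X i∉Y = record
      { vertex = z
      ; located = z-located
      ; closed = λ e′ → trans (≡.sym (stable e′ (All.tabulate λ _ →
          λ { (inj₁ (z≡ , _)) → not-site _ z≡ ; (inj₂ (z≡ , _)) → not-site _ z≡ }))) z-located
      }
      where
      same-site : ∀ {p} → site i ≡ site p → L p ≡ L i
      same-site i≡p = trans (≡.sym (label-site _)) (trans (cong label (≡.sym i≡p)) (label-site i))
      blocked : ∀ {p q} → Blocked i X Y p q → ¬ (site i ≡ site p × z ≡ site q)
      blocked b (i≡p , z≡q) with b (same-site i≡p)
      ... | inj₁ q∈X = All.lookup z∉X q∈X z≡q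
      ... | inj₂ p∈Y = All.lookup i∉Y p∈Y i≡p
      z-located : label z ≡ L i
      z-located = trans (≡.sym (stable e (All.map (λ (pq , qp) → Sum.[ blocked pq , blocked qp ])
        (proj₂ (toWitness ok))))) (label-site i)
      not-site : ∀ j → z ≢ site j
      not-site j z≡j with proj₁ (toWitness ok) j
        (trans (≡.sym (label-site j)) (trans (cong label (≡.sym z≡j)) z-located))
      ... | inj₁ refl = G .irrefl (≡.sym z≡j) e
      ... | inj₂ j∈X  = All.lookup z∉X j∈X z≡j

    vertices-of : ∀ {is} → All Private is → List (Fin n)
    vertices-of []       = []
    vertices-of (p ∷ ps) = p .vertex ∷ vertices-of ps

    -- A vertex in two of the closed neighbourhoods would carry two different labels.
    privates-far : ∀ {is} (ps : All Private is) → Different is → AllPairs (Far G) (vertices-of ps)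
    privates-far [] [] = []
    privates-far {i ∷ _} (p ∷ ps) (i≢ ∷ ≢s) = far-from ps i≢ ∷ privates-far ps ≢s
      where
      closed-label : ∀ {j} (q : Private j) {w} → w ∈ q .vertex ∷ neighbours G (q .vertex) → label w ≡ L j
      closed-label q (here refl) = q .located
      closed-label q (there w∈)  = q .closed (∈-neighbours⁻ G w∈)
      far-from : ∀ {js} (qs : All Private js) → All (λ j → L i ≢ L j) js → All (Far G (p .vertex)) (vertices-of qs)
      far-from [] [] = []
      far-from (q ∷ qs) (i≢j ∷ i≢) =
        (λ (w∈p , w∈q) → i≢j (trans (≡.sym (closed-label p w∈p)) (closed-label q w∈q))) ∷ far-from qs i≢

-- Sites 0, 1, 2 are a centre and its two leaves, sites 3, 4, 5 are a second
-- cherry.  Each coordinate of a label records the side of one of the four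
-- edges; β and δ tell whether the last leaf of one cherry separates its centre
-- from the other cherry.
arms : List (Fin 6 × Fin 6)
arms = (1F , 0F) ∷ (2F , 0F) ∷ (4F , 3F) ∷ (5F , 3F) ∷ []

labels : (β δ : Bool) → Fin 6 → Vec Bool 4
labels β δ 0F = false ∷ false ∷ false ∷ δ     ∷ []
labels β δ 1F = true  ∷ false ∷ false ∷ δ     ∷ []
labels β δ 2F = false ∷ true  ∷ false ∷ δ     ∷ []
labels β δ 3F = false ∷ β     ∷ false ∷ false ∷ []
labels β δ 4F = false ∷ β     ∷ true  ∷ false ∷ []
labels β δ 5F = false ∷ β     ∷ false ∷ true  ∷ []

-- Two cherries whose centres are not joined by a bridge

module _ {n : ℕ} (G : Graph n) (conn : Connected G) (3≤degree : ∀ v → 3 ≤ degree G v)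
  (σ-bound : (+ (4 * n) - + 19) / 5 ≤∞ σ G 4) where

  open Cut

  -- The leaves are named so that `v` is not on the side of `x₁`, nor `u` on that of `y₁`. In each
  -- of the four cases for `β` and `δ′` the six sites have five labels, exactly two sites sharing
  -- one.
  module Core {u x₁ x₂ v y₁ y₂ : Fin n} (¬uv : ¬ IsBridge G u v) (u≢v : u ≢ v)
    (ux : Cherry G x₁ u x₂) (vy : Cherry G y₁ v y₂)
    (c₁ : Cut G x₁ u) (c₂ : Cut G x₂ u) (c₃ : Cut G y₁ v) (c₄ : Cut G y₂ v)
    (α≡false : side c₁ v ≡ false) (γ≡false : side c₃ u ≡ false) where

    site : Fin 6 → Fin n
    site 0F = u
    site 1F = x₁
    site 2F = x₂
    site 3F = v
    site 4F = y₁
    site 5F = y₂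

    label : Fin n → Vec Bool 4
    label w = side c₁ w ∷ side c₂ w ∷ side c₃ w ∷ side c₄ w ∷ []

    β δ′ : Bool
    β  = side c₂ v
    δ′ = side c₄ u

    ux₁ = proj₁ ux
    ux₂ = proj₁ (proj₂ ux)
    x₁≢x₂ = proj₂ (proj₂ ux)
    vy₁ = proj₁ vy
    vy₂ = proj₁ (proj₂ vy)
    y₁≢y₂ = proj₂ (proj₂ vy)

    along : ∀ {a b s t} (c : Cut G a b) → IsBridge G s t → ¬ Joins a b s t → side c t ≡ side c s
    along c (e , _) ¬j = ≡.sym (stable c e ¬j)

    -- Were sx the edge yt, either x would be `t`, making st a bridge, or `s` would equal `t`.
    cross : ∀ {s t x y} → ¬ IsBridge G s t → s ≢ t → IsBridge G s x → ¬ Joins y t s x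
    cross ¬st s≢t sx (inj₁ (refl , refl)) = ¬st sx
    cross ¬st s≢t sx (inj₂ (s≡t , _))     = s≢t s≡t

    own : ∀ {s x y} → IsBridge G s x → x ≢ y → ¬ Joins y s s x
    own (e , _) _   (inj₁ (refl , refl)) = G .irrefl refl e
    own _       x≢y (inj₂ (_ , x≡y))     = x≢y x≡y

    ¬vu : ¬ IsBridge G v u
    ¬vu = ¬uv ∘ bridge-sym G

    v≢u : v ≢ u
    v≢u = u≢v ∘ ≡.sym

    vec : ∀ {a b c d a′ b′ c′ d′ : Bool} → a ≡ a′ → b ≡ b′ → c ≡ c′ → d ≡ d′ →
      _≡_ {A = Vec Bool 4} (a ∷ b ∷ c ∷ d ∷ []) (a′ ∷ b′ ∷ c′ ∷ d′ ∷ [])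
    vec refl refl refl refl = refl

    label-site : ∀ i → label (site i) ≡ labels β δ′ i
    label-site 0F = vec (side-b c₁) (side-b c₂) γ≡false refl
    label-site 1F = vec (side-a c₁)
      (trans (along c₂ ux₁ (own ux₁ x₁≢x₂)) (side-b c₂))
      (trans (along c₃ ux₁ (cross ¬uv u≢v ux₁)) γ≡false)
      (along c₄ ux₁ (cross ¬uv u≢v ux₁))
    label-site 2F = vec (trans (along c₁ ux₂ (own ux₂ (x₁≢x₂ ∘ ≡.sym))) (side-b c₁))
      (side-a c₂)
      (trans (along c₃ ux₂ (cross ¬uv u≢v ux₂)) γ≡false)
      (along c₄ ux₂ (cross ¬uv u≢v ux₂))
    label-site 3F = vec α≡false refl (side-b c₃) (side-b c₄)
    label-site 4F = vec (trans (along c₁ vy₁ (cross ¬vu v≢u vy₁)) α≡false)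
      (along c₂ vy₁ (cross ¬vu v≢u vy₁))
      (side-a c₃)
      (trans (along c₄ vy₁ (own vy₁ y₁≢y₂)) (side-b c₄))
    label-site 5F = vec (trans (along c₁ vy₂ (cross ¬vu v≢u vy₂)) α≡false)
      (along c₂ vy₂ (cross ¬vu v≢u vy₂))
      (trans (along c₃ vy₂ (own vy₂ (y₁≢y₂ ∘ ≡.sym))) (side-b c₃))
      (side-a c₄)

    label-stable : ∀ {x y} → Adj G x y → All (λ (p , q) → ¬ Joins (site p) (site q) x y) arms →
      label x ≡ label y
    label-stable e (j₁ ∷ j₂ ∷ j₃ ∷ j₄ ∷ []) =
      vec (stable c₁ e j₁) (stable c₂ e j₂) (stable c₃ e j₃) (stable c₄ e j₄)

    -- With literal Booleans in place of `β` and `δ′`, the conditions on labels can be evaluated.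
    module With (b d : Bool) (β≡ : β ≡ b) (δ≡ : δ′ ≡ d) where

      label-site′ : ∀ i → label (site i) ≡ labels b d i
      label-site′ i = trans (label-site i) (cong₂ (λ b d → labels b d i) β≡ δ≡)

      open Pieces (labels b d) arms public

      Own : Fin 6 → Set
      Own = Private G site label label-site′ label-stable

      -- Degree three allows two sites to be avoided; one site is given twice where one is enough.
      choose : ∀ i s t Y → {True (selects? i (s ∷ t ∷ []) Y)} → All (λ j → site i ≢ site j) Y → Own i
      choose i s t Y {ok} i∉Y =
        let z , e , z≢s , z≢t = third-neighbour G (3≤degree (site i)) (site s) (site t) in
        private-vertex G site label label-site′ label-stable i (s ∷ t ∷ []) Y {ok} e (z≢s ∷ z≢t ∷ []) i∉Y

      conclude : ∀ i₁ i₂ i₃ i₄ i₅ → {True (different? (i₁ ∷ i₂ ∷ i₃ ∷ i₄ ∷ i₅ ∷ []))} →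
        Own i₁ → Own i₂ → Own i₃ → Own i₄ → Own i₅ → ⊥
      conclude i₁ i₂ i₃ i₄ i₅ {ok} p₁ p₂ p₃ p₄ p₅ = five-far G σ-bound
        (privates-far G site label label-site′ label-stable
          (p₁ ∷ p₂ ∷ p₃ ∷ p₄ ∷ p₅ ∷ []) (toWitness ok))

    -- If u had no neighbour besides x₁, x₂ and v, then uv would be a bridge.
    extra-neighbour : β ≡ false → ∃[ z ] Adj G u z × z ≢ x₁ × z ≢ x₂ × z ≢ v
    extra-neighbour β≡false with third-neighbour G (3≤degree u) x₁ x₂
    ... | z , uz , z≢x₁ , z≢x₂ with z ≟ v
    ...   | no z≢v = z , uz , z≢x₁ , z≢x₂ , z≢v
    ...   | yes refl
      with any? (λ z → adj? G u z ×-dec (¬? (z ≟ x₁) ×-dec (¬? (z ≟ x₂) ×-dec ¬? (z ≟ v))))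
    ...     | yes found = found
    ...     | no none   = contradiction (uz , λ p → outside (star-closed Near step p (inj₁ refl))) ¬uv
      where
      -- This set misses `v`, and when `u` has no further neighbour it is closed under all edges
      -- except uv.
      Near : Fin n → Set
      Near w = w ≡ u ⊎ side c₁ w ≡ true ⊎ side c₂ w ≡ true
      outside : ¬ Near v
      outside (inj₁ v≡u) = v≢u v≡u
      outside (inj₂ (inj₁ eq)) with () ← trans (≡.sym eq) α≡false
      outside (inj₂ (inj₂ eq)) with () ← trans (≡.sym eq) β≡false
      preserve : ∀ {a w w′} (c : Cut G a u) → Adj G w w′ → side c w ≡ true →
        w′ ≡ u ⊎ side c w′ ≡ true
      preserve {a} {w} {w′} c e eq with joins? a u w w′
      ... | no ¬j = inj₂ (trans (≡.sym (stable c e ¬j)) eq)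
      ... | yes (inj₁ (_ , w′≡u)) = inj₁ w′≡u
      ... | yes (inj₂ (_ , refl)) = inj₂ (side-a c)
      step : ∀ {w w′} → Delete G u v w w′ → Near w → Near w′
      step {w} {w′} (e , ¬j) (inj₁ refl) with w′ ≟ x₁ | w′ ≟ x₂ | w′ ≟ v
      ... | yes refl | _ | _ = inj₂ (inj₁ (side-a c₁))
      ... | no _ | yes refl | _ = inj₂ (inj₂ (side-a c₂))
      ... | no _ | no _ | yes refl = contradiction (inj₁ (refl , refl)) ¬j
      ... | no ≢x₁ | no ≢x₂ | no ≢v = contradiction (w′ , e , ≢x₁ , ≢x₂ , ≢v) none
      step (e , _) (inj₂ (inj₁ eq)) = Sum.map id inj₁ (preserve c₁ e eq)
      step (e , _) (inj₂ (inj₂ eq)) = Sum.map id inj₂ (preserve c₂ e eq)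

    u≢y : ∀ {y} → IsBridge G v y → u ≢ y
    u≢y vy refl = ¬vu vy

    v≢x : ∀ {x} → IsBridge G u x → v ≢ x
    v≢x ux refl = ¬uv ux

    absurd : ⊥
    absurd with β in β≡ | δ′ in δ≡
    -- Here `u` and `v` share a label, so the neighbour of `u` must avoid `v` besides both leaves.
    ... | false | false =
      let z , e , z≢x₁ , z≢x₂ , z≢v = extra-neighbour β≡ in
      conclude 0F 1F 2F 4F 5F
        (private-vertex G site label label-site′ label-stable 0F (1F ∷ 2F ∷ 3F ∷ []) (3F ∷ []) e
          (z≢x₁ ∷ z≢x₂ ∷ z≢v ∷ []) (u≢v ∷ []))
        (choose 1F 0F 0F [] []) (choose 2F 0F 0F [] []) (choose 4F 3F 3F [] []) (choose 5F 3F 3F [] [])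
      where open With false false β≡ δ≡
    -- Here `u` and `y₂` share a label. Starting from `y₂`, only `v` and `u` have to be avoided;
    -- starting from `u`, three sites would be.
    ... | false | true = conclude 1F 2F 3F 4F 5F
        (choose 1F 0F 0F [] []) (choose 2F 0F 0F [] []) (choose 3F 4F 5F [] []) (choose 4F 3F 3F [] [])
        (choose 5F 3F 0F (0F ∷ []) (u≢y vy₂ ∘ ≡.sym ∷ []))
      where open With false true β≡ δ≡
    ... | true | false = conclude 0F 1F 2F 4F 5F
        (choose 0F 1F 2F [] []) (choose 1F 0F 0F [] [])
        (choose 2F 0F 3F (3F ∷ []) (v≢x ux₂ ∘ ≡.sym ∷ []))
        (choose 4F 3F 3F [] []) (choose 5F 3F 3F [] [])
      where open With true false β≡ δ≡
    ... | true | true = conclude 0F 1F 2F 3F 4F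
        (choose 0F 1F 2F [] []) (choose 1F 0F 0F [] []) meeting
        (choose 3F 4F 5F [] []) (choose 4F 3F 3F [] [])
      where
      open With true true β≡ δ≡
      meeting : Own 2F
      -- The leaves `x₂` and `y₂` share a label and may be the same vertex. In that case a neighbour
      -- other than `u` and `v` differs from `y₂` because G has no loops.
      meeting with x₂ ≟ y₂
      ... | no x₂≢y₂ = choose 2F 0F 5F (5F ∷ []) (x₂≢y₂ ∷ [])
      ... | yes x₂≡y₂ =
        let z , e , z≢u , z≢v = third-neighbour G (3≤degree x₂) u v in
        private-vertex G site label label-site′ label-stable 2F (0F ∷ 3F ∷ 5F ∷ []) [] e
          (z≢u ∷ z≢v ∷ (λ { refl → G .irrefl x₂≡y₂ e }) ∷ []) []

  -- The intersection of the two sides contains no end of the edges x₁u and x₂u, so it is closed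
  -- under adjacency. By connectivity a vertex in it would bring `u` into it.
  sides-disjoint : ∀ {u x₁ x₂ w} → Cherry G x₁ u x₂ → (c₁ : Cut G x₁ u) (c₂ : Cut G x₂ u) →
    side c₁ w ≡ true → side c₂ w ≡ false
  sides-disjoint {u} {x₁} {x₂} {w} ((ux₁ , _) , (ux₂ , _) , x₁≢x₂) c₁ c₂ w₁ =
    Bool.¬-not λ w₂ → centre c₁ (proj₁ (star-closed Both step (conn w u) (w₁ , w₂)))
    where
    Both : Fin n → Set
    Both w = side c₁ w ≡ true × side c₂ w ≡ true
    leaf : ∀ {x y} → Adj G u x → x ≢ y → (c : Cut G y u) → side c x ≢ true
    leaf ux x≢y c eq with () ← trans (≡.sym (side-b c)) (trans (stable c ux λ where
      (inj₁ (_ , refl)) → G .irrefl refl ux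
      (inj₂ (_ , x≡y)) → x≢y x≡y) eq)
    centre : ∀ {y} (c : Cut G y u) → side c u ≢ true
    centre c eq with () ← trans (≡.sym (side-b c)) eq
    step : ∀ {w w′} → Adj G w w′ → Both w → Both w′
    step e (w₁ , w₂) =
      trans (≡.sym (stable c₁ e λ where
        (inj₁ (refl , _)) → leaf ux₁ x₁≢x₂ c₂ w₂
        (inj₂ (refl , _)) → centre c₁ w₁)) w₁ ,
      trans (≡.sym (stable c₂ e λ where
        (inj₁ (refl , _)) → leaf ux₂ (x₁≢x₂ ∘ ≡.sym) c₁ w₁
        (inj₂ (refl , _)) → centre c₂ w₂)) w₂

  cherry-swap : ∀ {x y z} → Cherry G x y z → Cherry G z y x
  cherry-swap (yx , yz , x≢z) = yz , yx , x≢z ∘ ≡.sym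

  -- At most one leaf of a cherry has the other centre on its side. Swapping leaves so that it comes
  -- last meets the assumptions of `Core`.
  centres-joined : ∀ {u v x₁ x₂ y₁ y₂} → u ≢ v → ¬ IsBridge G u v →
    Cherry G x₁ u x₂ → ¬ Cherry G y₁ v y₂
  centres-joined {u} {v} u≢v ¬uv ux@(ux₁ , ux₂ , _) vy@(vy₁ , vy₂ , _)
    with bridge-cut G (bridge-sym G ux₁) | bridge-cut G (bridge-sym G ux₂)
       | bridge-cut G (bridge-sym G vy₁) | bridge-cut G (bridge-sym G vy₂)
  ... | c₁ | c₂ | c₃ | c₄ with side c₁ v in α | side c₃ u in γ
  ...   | false | false = Core.absurd ¬uv u≢v ux vy c₁ c₂ c₃ c₄ α γ
  ...   | true  | false = Core.absurd ¬uv u≢v (cherry-swap ux) vy c₂ c₁ c₃ c₄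
                            (sides-disjoint ux c₁ c₂ α) γ
  ...   | false | true  = Core.absurd ¬uv u≢v ux (cherry-swap vy) c₁ c₂ c₄ c₃
                            α (sides-disjoint vy c₃ c₄ γ)
  ...   | true  | true  = Core.absurd ¬uv u≢v (cherry-swap ux) (cherry-swap vy) c₂ c₁ c₄ c₃
                            (sides-disjoint ux c₁ c₂ α) (sides-disjoint vy c₃ c₄ γ)

theorem7 : (n : ℕ) → 21 ≤ n → (G : Graph n) →
    Connected G → ¬ Complete G → 3 ≤ δ G →
    LinearForest (C G) →
    (+ (4 * n) - + 19) / 5 ≤∞ σ G 4 →
    cfc G ≐ 2
theorem7 n 21≤n G conn ¬complete 3≤δ linear σ-bound =
  (_ , conflictFreeConnected G tree M) , cfc-lower G ¬complete
  where
  tree : SpanningTree G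
  tree = spanningTree G conn
  M : Marking G tree
  -- As n is positive, there is a vertex to serve as both ends when no bridge is marked.
  M = marking G conn tree (fromℕ< (ℕ.≤-trans (s≤s z≤n) 21≤n)) linear
    (centres-joined G conn (λ v → ℕ.≤-trans 3≤δ (δ≤degree G v)) σ-bound)
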